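{- Let $G$ be a countably infinite group with identity $e$ such that for each $g\in G\setminus\{e\}$ the set $\{x\in G:x^2=g\}$ is finite. Then there exists a subset $A\subseteq G$ such that $A\subsetneq\Delta(A)\subsetneq\Delta^2(A)\subsetneq\Delta^3(A)\subsetneq\cdots$.
   Context: For $A\subseteq G$, $\Delta(A)=\{g\in G:|gA\cap A|=\infty\}$, and $\Delta^{k+1}(A)=\Delta(\Delta^k(A))$ with $\Delta^1=\Delta$. -}

module Defs where

open import Level using (Level; _⊔_)
open import Algebra.Bundles using (Group)
open import Data.Nat using (ℕ; zero; suc)
open import Data.List using (List)
open import Data.List.Relation.Unary.Any using (Any)
open import Data.Product using (Σ; ∃; _×_; _,_)
open import Relation.Nullary using (¬_)
open import Relation.Binary.PropositionalEquality using (_≡_)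

module _ {c ℓ : Level} (G : Group c ℓ) where
  open Group G

  Subset : Set (Level.suc (c ⊔ ℓ))
  Subset = Carrier → Set (c ⊔ ℓ)

  Finite : {p : Level} → (Carrier → Set p) → Set (c ⊔ ℓ ⊔ p)
  Finite P = ∃ λ (xs : List Carrier) → ∀ x → P x → Any (x ≈_) xs

  Infinite : {p : Level} → (Carrier → Set p) → Set (c ⊔ ℓ ⊔ p)
  Infinite P = ¬ Finite P

  _·_ : Carrier → Subset → Subset
  (g · A) x = A (g ⁻¹ ∙ x)

  Δ : Subset → Subset
  Δ A g = Infinite (λ x → (g · A) x × A x)

  Δ^ : ℕ → Subset → Subset
  Δ^ zero A = A
  Δ^ (suc k) A = Δ (Δ^ k A)

  _⊆_ : Subset → Subset → Set (c ⊔ ℓ)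
  A ⊆ B = ∀ x → A x → B x

  _⊊_ : Subset → Subset → Set (c ⊔ ℓ)
  A ⊊ B = A ⊆ B × ∃ λ x → B x × ¬ A x

  CountablyInfinite : Set (c ⊔ ℓ)
  CountablyInfinite = ∃ λ (f : ℕ → Carrier) →
    (∀ m n → f m ≈ f n → m ≡ n) × (∀ g → ∃ λ n → f n ≈ g)

{-# OPTIONS --safe #-}
-- Build A in stages. Stage i takes a scheduled element g that already has level
-- at most ℓ + 1 and adds x, x⁻¹, y, y⁻¹ at level ℓ, where y = g⁻¹x; every task
-- recurs infinitely often. Let B k be the set of elements of level at most k.
-- Then B (k + 1) ⊆ Δ (B k), since g = x y⁻¹ is realised infinitely often. For
-- the converse, x is chosen so generic that, among the first i elements of G,
-- no quotients involving new elements occur except e, g and g⁻¹. The quotients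
-- to control are, up to inversion, x v with v old (finitely many bad x), the
-- squares x², (g⁻¹x)², g⁻¹x² and x g⁻¹ x = (x g⁻¹)² g (finitely many bad x by
-- the hypothesis on square roots, unless the value is e, g or g⁻¹), and the
-- conjugate x⁻¹ g x, which can be made either equal to g or large.
module Submission where

open import Defs
open import Level using (Level; _⊔_)
open import Algebra.Bundles using (Group)
import Algebra.Properties.Group as GroupProperties
open import Data.Empty using (⊥-elim)
open import Data.List using (List; []; _∷_; _++_; map; applyUpTo)
open import Data.List.Relation.Unary.Any using (Any; here; there)
import Data.List.Relation.Unary.Any as Any
import Data.List.Relation.Unary.Any.Properties as Any
open import Data.Nat using (ℕ; zero; suc; _+_; _≤_; _<_; _≤?_; z≤n; s≤s)
import Data.Nat as ℕ
import Data.Nat.Properties as ℕ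
open import Data.Product using (∃; _×_; _,_; proj₁; proj₂)
open import Data.Sum using (_⊎_; inj₁; inj₂)
open import Function using (_∘_)
open import Relation.Nullary using (¬_; Dec; yes; no; contradiction)
import Relation.Nullary.Decidable as Dec
open import Relation.Binary.PropositionalEquality as ≡ using (_≡_)
import Relation.Binary.Reasoning.Setoid as SetoidReasoning

-- Scheduling: each pair of numbers comes up at arbitrarily late stages.

-- Cantor's walk along the antidiagonals.
next : ℕ × ℕ → ℕ × ℕ
next (zero  , b) = suc b , zero
next (suc a , b) = a , suc b

unpair : ℕ → ℕ × ℕ
unpair zero    = zero , zero
unpair (suc i) = next (unpair i)

-- From `(b + a , 0)` each of the next `b` steps moves one unit from the first coordinate to the
-- second.
along-diagonal : ∀ b {a i} → unpair i ≡ (b + a , 0) → ∃ λ j → unpair j ≡ (a , b)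
along-diagonal zero {i = i} eq = i , eq
along-diagonal (suc b) {a} {i} eq
  with j , eq′ ← along-diagonal b {suc a} {i} (≡.trans eq (≡.cong (_, 0) (≡.sym (ℕ.+-suc b a))))
  = suc j , ≡.cong next eq′

diagonal-start : ∀ s → ∃ λ i → unpair i ≡ (s , 0)
diagonal-start zero = 0 , ≡.refl
diagonal-start (suc s)
  with i , eq ← diagonal-start s
  with j , eq′ ← along-diagonal s {0} {i} (≡.trans eq (≡.cong (_, 0) (≡.sym (ℕ.+-identityʳ s))))
  = suc j , ≡.cong next eq′

unpair-surjective : ∀ a b → ∃ λ i → unpair i ≡ (a , b)
unpair-surjective a b = along-diagonal b {i = proj₁ (diagonal-start (b + a))} (proj₂ (diagonal-start (b + a)))

next-proj₂ : ∀ p → proj₂ (next p) ≤ suc (proj₂ p)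
next-proj₂ (zero  , b) = z≤n
next-proj₂ (suc a , b) = ℕ.≤-refl

unpair-proj₂≤ : ∀ i → proj₂ (unpair i) ≤ i
unpair-proj₂≤ zero    = z≤n
unpair-proj₂≤ (suc i) = ℕ.≤-trans (next-proj₂ (unpair i)) (s≤s (unpair-proj₂≤ i))

schedule : ℕ → ℕ × ℕ
schedule i = unpair (proj₁ (unpair i))

-- Encode `(n , k)` as `p` and take the stage that decodes to `(p , N)`: the second coordinate is
-- discarded by `schedule`, but it forces the stage to be at least `N`.
schedule-recurs : ∀ n k N → ∃ λ i → N ≤ i × schedule i ≡ (n , k)
schedule-recurs n k N
  with p , p↦nk ← unpair-surjective n k
  with i , i↦pN ← unpair-surjective p N
  = i
  , ≡.subst (λ q → proj₂ q ≤ i) i↦pN (unpair-proj₂≤ i)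
  , ≡.trans (≡.cong (unpair ∘ proj₁) i↦pN) p↦nk

-- Closure properties of finite subsets.

module FiniteSubsets {c ℓ} (G : Group c ℓ) where
  open Group G

  private variable
    p q : Level
    P : Carrier → Set p
    Q : Carrier → Set q

  finite-⊆ : (∀ x → P x → Q x) → Finite G Q → Finite G P
  finite-⊆ P⊆Q (xs , Q⊆xs) = xs , λ x Px → Q⊆xs x (P⊆Q x Px)

  finite-⊎ : Finite G P → Finite G Q → Finite G (λ x → P x ⊎ Q x)
  finite-⊎ (xs , P⊆xs) (ys , Q⊆ys) = xs ++ ys , λ where
    x (inj₁ Px) → Any.++⁺ˡ (P⊆xs x Px)
    x (inj₂ Qx) → Any.++⁺ʳ xs (Q⊆ys x Qx)

  finite-Any : {Q : Carrier → Carrier → Set q} (xs : List Carrier) →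
    (∀ v → Finite G (Q v)) → Finite G (λ x → Any (λ v → Q v x) xs)
  finite-Any []       fin = [] , λ _ ()
  finite-Any (v ∷ xs) fin = finite-⊆ (λ _ → Any.toSum) (finite-⊎ (fin v) (finite-Any xs fin))

  finite-∃ : {Q : Carrier → Carrier → Set q} → Finite G P →
    (∀ v → Finite G (Q v)) → (∀ {v w x} → v ≈ w → Q v x → Q w x) →
    Finite G (λ x → ∃ λ v → P v × Q v x)
  finite-∃ (vs , P⊆vs) fin resp =
    finite-⊆ (λ { x (v , Pv , Qvx) → Any.map (λ v≈w → resp v≈w Qvx) (P⊆vs v Pv) })
             (finite-Any vs fin)

  finite-preimage : (φ ψ : Carrier → Carrier) → (∀ {x y} → x ≈ y → ψ x ≈ ψ y) →
    (∀ x → ψ (φ x) ≈ x) → Finite G P → Finite G (P ∘ φ)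
  finite-preimage φ ψ ψ-cong ψφ≈id (xs , P⊆xs) =
    map ψ xs , λ x Pφx →
      Any.map⁺ (Any.map (λ φx≈z → trans (sym (ψφ≈id x)) (ψ-cong φx≈z)) (P⊆xs (φ x) Pφx))

module Translations {c ℓ} (G : Group c ℓ) where
  open Group G
  open GroupProperties G
  open FiniteSubsets G

  private variable
    p : Level
    P : Carrier → Set p

  finite-∙ˡ : ∀ a → Finite G P → Finite G (λ x → P (a ∙ x))
  finite-∙ˡ a = finite-preimage (a ∙_) (a ⁻¹ ∙_) ∙-congˡ (\\-leftDividesʳ a)

  finite-∙ʳ : ∀ a → Finite G P → Finite G (λ x → P (x ∙ a))
  finite-∙ʳ a = finite-preimage (_∙ a) (_∙ a ⁻¹) ∙-congʳ (//-rightDividesʳ a)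

module Construction {c ℓ} (G : Group c ℓ)
  (enum : ℕ → Group.Carrier G)
  (enum-injective : ∀ m n → Group._≈_ G (enum m) (enum n) → m ≡ n)
  (enum-surjective : ∀ g → ∃ λ n → Group._≈_ G (enum n) g)
  (square-roots : ∀ g → ¬ Group._≈_ G g (Group.ε G) →
    Finite G (λ x → Group._≈_ G (Group._∙_ G x x) g))
  where

  open Group G
  open GroupProperties G
  open FiniteSubsets G
  open Translations G
  open SetoidReasoning setoid

  private variable
    p : Level

  -- Decidable equality and a size function from the enumeration.

  index : Carrier → ℕ
  index = proj₁ ∘ enum-surjective

  enum-index : ∀ g → enum (index g) ≈ g
  enum-index = proj₂ ∘ enum-surjective

  index-cong : ∀ {g h} → g ≈ h → index g ≡ index h
  index-cong {g} {h} g≈h =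
    enum-injective _ _ (trans (enum-index g) (trans g≈h (sym (enum-index h))))

  index-injective : ∀ {g h} → index g ≡ index h → g ≈ h
  index-injective {g} {h} eq =
    trans (sym (enum-index g)) (trans (reflexive (≡.cong enum eq)) (enum-index h))

  _≈?_ : ∀ g h → Dec (g ≈ h)
  g ≈? h = Dec.map′ index-injective index-cong (index g ℕ.≟ index h)

  -- Taking the maximum with the index of the inverse makes smallness invariant under inversion,
  -- which halves the later case analysis.
  size : Carrier → ℕ
  size g = index g ℕ.⊔ index (g ⁻¹)

  size-cong : ∀ {g h} → g ≈ h → size g ≡ size h
  size-cong g≈h = ≡.cong₂ ℕ._⊔_ (index-cong g≈h) (index-cong (⁻¹-cong g≈h))

  size-⁻¹ : ∀ g → size (g ⁻¹) ≡ size g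
  size-⁻¹ g = ≡.trans (≡.cong (index (g ⁻¹) ℕ.⊔_) (index-cong (⁻¹-involutive g)))
                      (ℕ.⊔-comm (index (g ⁻¹)) (index g))

  Small : ℕ → Carrier → Set
  Small i g = size g < i

  small-cong : ∀ {i g h} → g ≈ h → Small i g → Small i h
  small-cong {i} g≈h = ≡.subst (_< i) (size-cong g≈h)

  small-⁻¹ : ∀ {i g} → Small i g → Small i (g ⁻¹)
  small-⁻¹ {i} {g} = ≡.subst (_< i) (≡.sym (size-⁻¹ g))

  finite-small : ∀ i → Finite G (Small i)
  finite-small i = applyUpTo enum i , λ g g-small →
    Any.applyUpTo⁺ enum (sym (enum-index g)) (ℕ.≤-<-trans (ℕ.m≤m⊔n (index g) _) g-small)

  finite⇒small : {P : Carrier → Set p} → Finite G P → ∃ λ N → ∀ x → P x → Small N x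
  finite⇒small {P = P} (xs , P⊆xs) = proj₁ (bound xs) , λ x Px → proj₂ (bound xs) x (P⊆xs x Px)
    where
    bound : ∀ xs → ∃ λ N → ∀ x → Any (x ≈_) xs → Small N x
    bound [] = 0 , λ _ ()
    bound (z ∷ xs) with N , xs<N ← bound xs = suc (size z) ℕ.⊔ N , λ where
      x (here x≈z) → ℕ.<-≤-trans (s≤s (ℕ.≤-reflexive (size-cong x≈z))) (ℕ.m≤m⊔n _ N)
      x (there x∈xs) → ℕ.<-≤-trans (xs<N x x∈xs) (ℕ.m≤n⊔m (suc (size z)) N)

  fresh : {P : Carrier → Set p} → Finite G P → ∃ λ x → ¬ P x
  fresh fin with N , P<N ← finite⇒small fin = enum N , λ Px →
    ℕ.<-irrefl ≡.refl (ℕ.≤-<-trans (ℕ.≤-trans (ℕ.≤-reflexive (≡.sym (index-enum N))) (ℕ.m≤m⊔n _ _))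
                                   (P<N (enum N) Px))
    where
    index-enum : ∀ n → index (enum n) ≡ n
    index-enum n = enum-injective _ _ (enum-index (enum n))

  -- Avoiding small squares and small conjugates.

  -- A finite union of sets of square roots. The value `ε` is excluded because there may be
  -- infinitely many involutions.
  finite-square : {P : Carrier → Set p} → Finite G P →
    Finite G (λ x → P (x ∙ x) × ¬ (x ∙ x ≈ ε))
  finite-square {P = P} finP =
    finite-⊆ (λ { x (Pxx , xx≉ε) → x ∙ x , Pxx , xx≉ε , refl })
             (finite-∃ finP nontrivial-square-roots
               λ v≈w (v≉ε , xx≈v) → (λ w≈ε → v≉ε (trans v≈w w≈ε)) , trans xx≈v v≈w)
    where
    nontrivial-square-roots : ∀ v → Finite G (λ x → ¬ (v ≈ ε) × x ∙ x ≈ v)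
    nontrivial-square-roots v with v ≈? ε
    ... | yes v≈ε = [] , λ _ (v≉ε , _) → contradiction v≈ε v≉ε
    ... | no  v≉ε = finite-⊆ (λ _ → proj₂) (square-roots v v≉ε)

  -- With `y = g⁻¹ x` this is the quotient `y⁻¹ x`, which has to be controlled without the
  -- hypothesis on square roots.
  conj : Carrier → Carrier → Carrier
  conj g x = x ⁻¹ ∙ (g ∙ x)

  conj-quotient : ∀ g a b → conj g a ≈ conj g b → conj g (b ∙ a ⁻¹) ≈ g
  conj-quotient g a b eq = begin
    (b ∙ a ⁻¹) ⁻¹ ∙ (g ∙ (b ∙ a ⁻¹))    ≈⟨ ∙-congʳ (⁻¹-anti-homo-// b a) ⟩
    (a ∙ b ⁻¹) ∙ (g ∙ (b ∙ a ⁻¹))       ≈⟨ assoc a (b ⁻¹) _ ⟩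
    a ∙ (b ⁻¹ ∙ (g ∙ (b ∙ a ⁻¹)))       ≈⟨ ∙-congˡ (∙-congˡ (assoc g b (a ⁻¹))) ⟨
    a ∙ (b ⁻¹ ∙ ((g ∙ b) ∙ a ⁻¹))       ≈⟨ ∙-congˡ (assoc (b ⁻¹) (g ∙ b) (a ⁻¹)) ⟨
    a ∙ (conj g b ∙ a ⁻¹)               ≈⟨ ∙-congˡ (∙-congʳ eq) ⟨
    a ∙ (conj g a ∙ a ⁻¹)               ≈⟨ assoc a (conj g a) (a ⁻¹) ⟨
    (a ∙ (a ⁻¹ ∙ (g ∙ a))) ∙ a ⁻¹       ≈⟨ ∙-congʳ (\\-leftDividesˡ a (g ∙ a)) ⟩
    (g ∙ a) ∙ a ⁻¹                      ≈⟨ //-rightDividesʳ a g ⟩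
    g                                   ∎

  -- If x and x′ both conjugate g to the head of the list, then x′ x⁻¹ centralises g.
  fresh-conj-∉ : {P : Carrier → Set p} → Finite G P → ∀ g hs →
    ∃ λ x → ¬ P x × (¬ Any (conj g x ≈_) hs ⊎ conj g x ≈ g)
  fresh-conj-∉ finP g [] with x , ¬Px ← fresh finP = x , ¬Px , inj₁ λ ()
  fresh-conj-∉ finP g (h ∷ hs) with fresh-conj-∉ finP g hs
  ... | x , ¬Px , inj₂ central = x , ¬Px , inj₂ central
  ... | x , ¬Px , inj₁ x∉hs with conj g x ≈? h
  ...   | no x≉h = x , ¬Px , inj₁ λ { (here x≈h) → x≉h x≈h ; (there x∈hs) → x∉hs x∈hs }
  -- The second choice `x′` also keeps `x′ ∙ x ⁻¹` out of `P`, since that quotient may become the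
  -- witness.
  ...   | yes x≈h with fresh-conj-∉ (finite-⊎ finP (finite-∙ʳ (x ⁻¹) finP)) g hs
  ...     | x′ , ¬Px′ , inj₂ central = x′ , ¬Px′ ∘ inj₁ , inj₂ central
  ...     | x′ , ¬Px′ , inj₁ x′∉hs with conj g x′ ≈? h
  ...       | no x′≉h = x′ , ¬Px′ ∘ inj₁ ,
    inj₁ λ { (here x′≈h) → x′≉h x′≈h ; (there x′∈hs) → x′∉hs x′∈hs }
  ...       | yes x′≈h = x′ ∙ x ⁻¹ , ¬Px′ ∘ inj₂ ,
    inj₂ (conj-quotient g x x′ (trans x≈h (sym x′≈h)))

  fresh-conj : {P : Carrier → Set p} → Finite G P → ∀ g i →
    ∃ λ x → ¬ P x × (Small i (conj g x) → conj g x ≈ g)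
  fresh-conj finP g i with fresh-conj-∉ finP g (proj₁ (finite-small i))
  ... | x , ¬Px , inj₁ x∉hs    =
    x , ¬Px , λ small → contradiction (proj₂ (finite-small i) _ small) x∉hs
  ... | x , ¬Px , inj₂ central = x , ¬Px , λ _ → central

  -- Finite states and their levels.

  data New (x y u : Carrier) : Set (c ⊔ ℓ) where
    new-x   : u ≈ x    → New x y u
    new-x⁻¹ : u ≈ x ⁻¹ → New x y u
    new-y   : u ≈ y    → New x y u
    new-y⁻¹ : u ≈ y ⁻¹ → New x y u

  new-⁻¹ : ∀ {x y u} → New x y u → New x y (u ⁻¹)
  new-⁻¹ (new-x u≈x)     = new-x⁻¹ (⁻¹-cong u≈x)
  new-⁻¹ (new-x⁻¹ u≈x⁻¹) = new-x (trans (⁻¹-cong u≈x⁻¹) (⁻¹-involutive _))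
  new-⁻¹ (new-y u≈y)     = new-y⁻¹ (⁻¹-cong u≈y)
  new-⁻¹ (new-y⁻¹ u≈y⁻¹) = new-y (trans (⁻¹-cong u≈y⁻¹) (⁻¹-involutive _))

  new-cong : ∀ {x y u v} → u ≈ v → New x y u → New x y v
  new-cong u≈v (new-x eq)   = new-x (trans (sym u≈v) eq)
  new-cong u≈v (new-x⁻¹ eq) = new-x⁻¹ (trans (sym u≈v) eq)
  new-cong u≈v (new-y eq)   = new-y (trans (sym u≈v) eq)
  new-cong u≈v (new-y⁻¹ eq) = new-y⁻¹ (trans (sym u≈v) eq)

  finite-new : ∀ x y → Finite G (New x y)
  finite-new x y = x ∷ x ⁻¹ ∷ y ∷ y ⁻¹ ∷ [] , λ where
    u (new-x eq)   → here eq
    u (new-x⁻¹ eq) → there (here eq)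
    u (new-y eq)   → there (there (here eq))
    u (new-y⁻¹ eq) → there (there (there (here eq)))

  new? : ∀ x y u → Dec (New x y u)
  new? x y u = Dec.map′ from to (Any.any? (u ≈?_) (proj₁ (finite-new x y)))
    where
    to : New x y u → Any (u ≈_) (proj₁ (finite-new x y))
    to = proj₂ (finite-new x y) u
    from : Any (u ≈_) (proj₁ (finite-new x y)) → New x y u
    from (here eq)                         = new-x eq
    from (there (here eq))                 = new-x⁻¹ eq
    from (there (there (here eq)))         = new-y eq
    from (there (there (there (here eq)))) = new-y⁻¹ eq

  -- (x , y , l) stands for x, x⁻¹, y, y⁻¹ at level l.
  State : Set c
  State = List (Carrier × Carrier × ℕ)

  -- `ε` is present in every state and at every level. It thus serves as a default target, and
  -- genericity against old elements also covers the new elements themselves.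
  data In (k : ℕ) : State → Carrier → Set (c ⊔ ℓ) where
    unit  : ∀ {S u} → u ≈ ε → In k S u
    newer : ∀ {S x y l u} → l ≤ k → New x y u → In k ((x , y , l) ∷ S) u
    older : ∀ {S s u} → In k S u → In k (s ∷ S) u

  in-⁻¹ : ∀ {k S u} → In k S u → In k S (u ⁻¹)
  in-⁻¹ (unit u≈ε)    = unit (trans (⁻¹-cong u≈ε) ε⁻¹≈ε)
  in-⁻¹ (newer l≤k n) = newer l≤k (new-⁻¹ n)
  in-⁻¹ (older u∈S)   = older (in-⁻¹ u∈S)

  in-cong : ∀ {k S u v} → u ≈ v → In k S u → In k S v
  in-cong u≈v (unit u≈ε)    = unit (trans (sym u≈v) u≈ε)
  in-cong u≈v (newer l≤k n) = newer l≤k (new-cong u≈v n)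
  in-cong u≈v (older u∈S)   = older (in-cong u≈v u∈S)

  in-level : ∀ {k m S u} → k ≤ m → In k S u → In m S u
  in-level k≤m (unit u≈ε)    = unit u≈ε
  in-level k≤m (newer l≤k n) = newer (ℕ.≤-trans l≤k k≤m) n
  in-level k≤m (older u∈S)   = older (in-level k≤m u∈S)

  in? : ∀ k S u → Dec (In k S u)
  in? k S u with u ≈? ε
  in? k S u | yes u≈ε = yes (unit u≈ε)
  in? k [] u | no u≉ε = no λ { (unit u≈ε) → u≉ε u≈ε }
  in? k ((x , y , l) ∷ S) u | no u≉ε with in? k S u | l ≤? k | new? x y u
  ... | yes u∈S | _       | _      = yes (older u∈S)
  ... | no _    | yes l≤k | yes n  = yes (newer l≤k n)
  ... | no u∉S  | no l≰k  | _      =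
    no λ { (unit u≈ε) → u≉ε u≈ε ; (newer l≤k _) → l≰k l≤k ; (older u∈S) → u∉S u∈S }
  ... | no u∉S  | _       | no ¬n  =
    no λ { (unit u≈ε) → u≉ε u≈ε ; (newer _ n) → ¬n n ; (older u∈S) → u∉S u∈S }

  finite-in : ∀ S → Finite G (λ u → ∃ λ k → In k S u)
  finite-in [] = ε ∷ [] , λ { u (k , unit u≈ε) → here u≈ε }
  finite-in ((x , y , l) ∷ S) = finite-⊆ split (finite-⊎ (finite-new x y) (finite-in S))
    where
    split : ∀ u → (∃ λ k → In k ((x , y , l) ∷ S) u) → New x y u ⊎ ∃ λ k → In k S u
    split u (k , unit u≈ε)  = inj₂ (k , unit u≈ε)
    split u (k , newer _ n) = inj₁ n
    split u (k , older u∈S) = inj₂ (k , u∈S)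

  -- Generic choice of the new elements.

  Expected : Carrier → Carrier → Set ℓ
  Expected g w = w ≈ ε ⊎ w ≈ g ⊎ w ≈ g ⁻¹

  expected-⁻¹ : ∀ {g w} → Expected g w → Expected g (w ⁻¹)
  expected-⁻¹ (inj₁ w≈ε)          = inj₁ (trans (⁻¹-cong w≈ε) ε⁻¹≈ε)
  expected-⁻¹ (inj₂ (inj₁ w≈g))   = inj₂ (inj₂ (⁻¹-cong w≈g))
  expected-⁻¹ (inj₂ (inj₂ w≈g⁻¹)) = inj₂ (inj₁ (trans (⁻¹-cong w≈g⁻¹) (⁻¹-involutive _)))

  expected-cong : ∀ {g v w} → v ≈ w → Expected g v → Expected g w
  expected-cong v≈w (inj₁ eq)        = inj₁ (trans (sym v≈w) eq)
  expected-cong v≈w (inj₂ (inj₁ eq)) = inj₂ (inj₁ (trans (sym v≈w) eq))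
  expected-cong v≈w (inj₂ (inj₂ eq)) = inj₂ (inj₂ (trans (sym v≈w) eq))

  -- Products stand in for quotients because old and new elements are each closed under inversion.
  -- For the same reason an old factor on the left needs no separate clause.
  record Generic (i : ℕ) (S : State) (g x : Carrier) : Set (c ⊔ ℓ) where
    field
      new-old : ∀ {k u v} → New x (g ⁻¹ ∙ x) u → In k S v → ¬ Small i (u ∙ v)
      new-new : ∀ {u v} → New x (g ⁻¹ ∙ x) u → New x (g ⁻¹ ∙ x) v →
                Small i (u ∙ v) → Expected g (u ∙ v)

  x∙y⁻¹≈g : ∀ g x → x ∙ (g ⁻¹ ∙ x) ⁻¹ ≈ g
  x∙y⁻¹≈g g x = trans (∙-congˡ (⁻¹-anti-homo-\\ g x)) (\\-leftDividesˡ x g)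

  module _ (i : ℕ) (S : State) (g : Carrier) where

    -- Both orders are recorded because `b⁻¹ v` is the inverse of `v⁻¹ b`.
    NearOld : Carrier → Set (c ⊔ ℓ)
    NearOld b = ∃ λ v → (∃ λ k → In k S v) × (Small i (b ∙ v) ⊎ Small i (v ∙ b))

    SquareIn : (Carrier → Set) → Carrier → Set ℓ
    SquareIn P x = P (x ∙ x) × ¬ (x ∙ x ≈ ε)

    -- With `y = g⁻¹ x`, the three lines exclude small products with old elements, small values of
    -- `x²` and `y²`, and small values of `x y = (x g⁻¹)² g` and `y x = g⁻¹ x²`.
    Bad : Carrier → Set (c ⊔ ℓ)
    Bad x = (NearOld x ⊎ NearOld (g ⁻¹ ∙ x))
          ⊎ (SquareIn (Small i) x ⊎ SquareIn (Small i) (g ⁻¹ ∙ x))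
          ⊎ (SquareIn (λ w → Small i (w ∙ g)) (x ∙ g ⁻¹) ⊎ SquareIn (λ w → Small i (g ⁻¹ ∙ w)) x)

    finite-near-old : Finite G NearOld
    finite-near-old = finite-∃ (finite-in S)
      (λ v → finite-⊎ (finite-∙ʳ v (finite-small i)) (finite-∙ˡ v (finite-small i)))
      λ where
        v≈w (inj₁ small) → inj₁ (small-cong (∙-congˡ v≈w) small)
        v≈w (inj₂ small) → inj₂ (small-cong (∙-congʳ v≈w) small)

    finite-bad : Finite G Bad
    finite-bad =
      finite-⊎ (finite-⊎ finite-near-old (finite-∙ˡ (g ⁻¹) finite-near-old))
      (finite-⊎ (finite-⊎ (finite-square (finite-small i))
                          (finite-∙ˡ (g ⁻¹) (finite-square (finite-small i))))
                (finite-⊎ (finite-∙ʳ (g ⁻¹) (finite-square (finite-∙ʳ g (finite-small i))))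
                          (finite-square (finite-∙ˡ (g ⁻¹) (finite-small i)))))

    not-near-old : ∀ {b k v} → ¬ NearOld b → In k S v → ¬ Small i (b ∙ v) × ¬ Small i (b ⁻¹ ∙ v)
    not-near-old {b} {k} {v} ¬near v∈S =
      (λ small → ¬near (v , (k , v∈S) , inj₁ small)) ,
      (λ small → ¬near (v ⁻¹ , (k , in-⁻¹ v∈S) , inj₂ (small-cong (⁻¹-anti-homo-\\ b v) (small-⁻¹ small))))

    OK : Carrier → Set ℓ
    OK w = Small i w → Expected g w

    ok-cong : ∀ {v w} → v ≈ w → OK v → OK w
    ok-cong v≈w ok small = expected-cong v≈w (ok (small-cong (sym v≈w) small))

    ok-⁻¹ : ∀ {w} → OK w → OK (w ⁻¹)
    ok-⁻¹ ok small = expected-⁻¹ (ok (small-cong (⁻¹-involutive _) (small-⁻¹ small)))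

    -- If the square is `ε`, its exclusion gives no information, and `w` must then be an expected
    -- value: `ε` for `x x` and `y y`, `g` for `x y`, `g⁻¹` for `y x`.
    ok-square : ∀ P x {w} → ¬ SquareIn P x → (Small i w → P (x ∙ x)) →
      (x ∙ x ≈ ε → Expected g w) → OK w
    ok-square P x ¬sq P-sq expected small with (x ∙ x) ≈? ε
    ... | yes xx≈ε = expected xx≈ε
    ... | no  xx≉ε = contradiction (P-sq small , xx≉ε) ¬sq

    module _ {x : Carrier} (¬bad : ¬ Bad x)
      (conj-large : Small i (conj g x) → conj g x ≈ g) where

      y : Carrier
      y = g ⁻¹ ∙ x

      ok-xx : OK (x ∙ x)
      ok-xx = ok-square (Small i) x (¬bad ∘ inj₂ ∘ inj₁ ∘ inj₁) (λ small → small) inj₁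

      ok-yy : OK (y ∙ y)
      ok-yy = ok-square (Small i) y (¬bad ∘ inj₂ ∘ inj₁ ∘ inj₂) (λ small → small) inj₁

      ok-xy : OK (x ∙ y)
      ok-xy = ok-square (λ w → Small i (w ∙ g)) (x ∙ g ⁻¹) (¬bad ∘ inj₂ ∘ inj₂ ∘ inj₁)
        (small-cong xy≈) (λ sq≈ε → inj₂ (inj₁ (trans xy≈ (trans (∙-congʳ sq≈ε) (identityˡ g)))))
        where
        xy≈ : x ∙ y ≈ ((x ∙ g ⁻¹) ∙ (x ∙ g ⁻¹)) ∙ g
        xy≈ = begin
          x ∙ (g ⁻¹ ∙ x)                    ≈⟨ assoc x (g ⁻¹) x ⟨
          (x ∙ g ⁻¹) ∙ x                    ≈⟨ ∙-congˡ (//-rightDividesˡ g x) ⟨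
          (x ∙ g ⁻¹) ∙ ((x ∙ g ⁻¹) ∙ g)     ≈⟨ assoc _ _ g ⟨
          ((x ∙ g ⁻¹) ∙ (x ∙ g ⁻¹)) ∙ g     ∎

      ok-yx : OK (y ∙ x)
      ok-yx = ok-square (λ w → Small i (g ⁻¹ ∙ w)) x (¬bad ∘ inj₂ ∘ inj₂ ∘ inj₂)
        (small-cong (assoc (g ⁻¹) x x))
        (λ xx≈ε → inj₂ (inj₂ (trans (assoc (g ⁻¹) x x) (trans (∙-congˡ xx≈ε) (identityʳ _)))))

      ok-y⁻¹x : OK (y ⁻¹ ∙ x)
      ok-y⁻¹x small = inj₂ (inj₁ (trans y⁻¹x≈ (conj-large (small-cong y⁻¹x≈ small))))
        where
        y⁻¹x≈ : y ⁻¹ ∙ x ≈ conj g x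
        y⁻¹x≈ = trans (∙-congʳ (⁻¹-anti-homo-\\ g x)) (assoc (x ⁻¹) g x)

      ok-xy⁻¹ : OK (x ∙ y ⁻¹)
      ok-xy⁻¹ _ = inj₂ (inj₁ (x∙y⁻¹≈g g x))

      ok-yx⁻¹ : OK (y ∙ x ⁻¹)
      ok-yx⁻¹ _ = inj₂ (inj₂ (//-rightDividesʳ x (g ⁻¹)))

      ok-inverses : ∀ a b → OK (b ∙ a) → OK (a ⁻¹ ∙ b ⁻¹)
      ok-inverses a b ok = ok-cong (⁻¹-anti-homo-∙ b a) (ok-⁻¹ ok)

      -- Of the sixteen products four are `ε`, seven are treated above, and the remaining five are
      -- inverses of some of those seven.
      ok-new-new : ∀ {u v} → New x y u → New x y v → OK (u ∙ v)
      ok-new-new (new-x p)   (new-x q)   = ok-cong (sym (∙-cong p q)) ok-xx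
      ok-new-new (new-x p)   (new-x⁻¹ q) = λ _ → inj₁ (trans (∙-cong p q) (inverseʳ x))
      ok-new-new (new-x p)   (new-y q)   = ok-cong (sym (∙-cong p q)) ok-xy
      ok-new-new (new-x p)   (new-y⁻¹ q) = ok-cong (sym (∙-cong p q)) ok-xy⁻¹
      ok-new-new (new-x⁻¹ p) (new-x q)   = λ _ → inj₁ (trans (∙-cong p q) (inverseˡ x))
      ok-new-new (new-x⁻¹ p) (new-x⁻¹ q) = ok-cong (sym (∙-cong p q)) (ok-inverses x x ok-xx)
      ok-new-new (new-x⁻¹ p) (new-y q)   =
        ok-cong (trans (⁻¹-anti-homo-\\ y x) (sym (∙-cong p q))) (ok-⁻¹ ok-y⁻¹x)
      ok-new-new (new-x⁻¹ p) (new-y⁻¹ q) = ok-cong (sym (∙-cong p q)) (ok-inverses x y ok-yx)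
      ok-new-new (new-y p)   (new-x q)   = ok-cong (sym (∙-cong p q)) ok-yx
      ok-new-new (new-y p)   (new-x⁻¹ q) = ok-cong (sym (∙-cong p q)) ok-yx⁻¹
      ok-new-new (new-y p)   (new-y q)   = ok-cong (sym (∙-cong p q)) ok-yy
      ok-new-new (new-y p)   (new-y⁻¹ q) = λ _ → inj₁ (trans (∙-cong p q) (inverseʳ y))
      ok-new-new (new-y⁻¹ p) (new-x q)   = ok-cong (sym (∙-cong p q)) ok-y⁻¹x
      ok-new-new (new-y⁻¹ p) (new-x⁻¹ q) = ok-cong (sym (∙-cong p q)) (ok-inverses y x ok-xy)
      ok-new-new (new-y⁻¹ p) (new-y q)   = λ _ → inj₁ (trans (∙-cong p q) (inverseˡ y))
      ok-new-new (new-y⁻¹ p) (new-y⁻¹ q) = ok-cong (sym (∙-cong p q)) (ok-inverses y y ok-yy)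

      large-new-old : ∀ {k u v} → New x y u → In k S v → ¬ Small i (u ∙ v)
      large-new-old (new-x p)   v∈S =
        proj₁ (not-near-old (¬bad ∘ inj₁ ∘ inj₁) v∈S) ∘ small-cong (∙-congʳ p)
      large-new-old (new-x⁻¹ p) v∈S =
        proj₂ (not-near-old (¬bad ∘ inj₁ ∘ inj₁) v∈S) ∘ small-cong (∙-congʳ p)
      large-new-old (new-y p)   v∈S =
        proj₁ (not-near-old (¬bad ∘ inj₁ ∘ inj₂) v∈S) ∘ small-cong (∙-congʳ p)
      large-new-old (new-y⁻¹ p) v∈S =
        proj₂ (not-near-old (¬bad ∘ inj₁ ∘ inj₂) v∈S) ∘ small-cong (∙-congʳ p)

    -- Later arguments use only the properties in `Generic`, so the witness stays opaque.
    abstract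
      generic : ∃ (Generic i S g)
      generic with x , ¬bad , conj-large ← fresh-conj finite-bad g i = x , record
        { new-old = large-new-old ¬bad conj-large
        ; new-new = ok-new-new ¬bad conj-large
        }

  -- The stages of the construction.

  -- If `enum n` has not yet appeared at level at most `k + 1`, the target is `ε`; the stage still
  -- adds new elements at level `k`.
  task : ℕ × ℕ → State → Carrier
  task (n , k) S with in? (suc k) S (enum n)
  ... | yes _ = enum n
  ... | no  _ = ε

  task-in : ∀ t S → In (suc (proj₂ t)) S (task t S)
  task-in (n , k) S with in? (suc k) S (enum n)
  ... | yes n∈S = n∈S
  ... | no  _   = unit refl

  task-enum : ∀ n k S → In (suc k) S (enum n) → task (n , k) S ≡ enum n
  task-enum n k S n∈S with in? (suc k) S (enum n)
  ... | yes _   = ≡.refl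
  ... | no  n∉S = contradiction n∈S n∉S

  level : ℕ → ℕ
  level i = proj₂ (schedule i)

  mutual
    state : ℕ → State
    state zero    = []
    state (suc i) = (x-at i , target i ⁻¹ ∙ x-at i , level i) ∷ state i

    target : ℕ → Carrier
    target i = task (schedule i) (state i)

    x-at : ℕ → Carrier
    x-at i = proj₁ (generic i (state i) (target i))

  module Step (i : ℕ) = Generic (proj₂ (generic i (state i) (target i)))

  NewAt : ℕ → Carrier → Set (c ⊔ ℓ)
  NewAt i = New (x-at i) (target i ⁻¹ ∙ x-at i)

  state-mono : ∀ {k i j u} → i ≤ j → In k (state i) u → In k (state j) u
  state-mono i≤j = go (ℕ.≤⇒≤′ i≤j)
    where
    go : ∀ {k i j u} → i ℕ.≤′ j → In k (state i) u → In k (state j) u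
    go ℕ.≤′-refl       u∈ = u∈
    go (ℕ.≤′-step i≤j) u∈ = older (go i≤j u∈)

  B : ℕ → Subset G
  B k u = ∃ λ i → In k (state i) u

  -- Genericity is applied to the product of `u` with the old element `ε`.
  new-large : ∀ {i u} → NewAt i u → ¬ Small i u
  new-large {i} n small =
    Step.new-old i {k = 0} n (unit refl) (small-cong (sym (identityʳ _)) small)

  -- If `u` were old, so would be `u⁻¹`, and their product `ε` would be a small product of a new and
  -- an old element.
  new-not-old : ∀ {i k u} → Small i ε → NewAt i u → ¬ In k (state i) u
  new-not-old {i} small-ε n u∈ =
    Step.new-old i n (in-⁻¹ u∈) (small-cong (sym (inverseʳ _)) small-ε)

  in-before : ∀ {k i u} d → Small i u → In k (state (d + i)) u → In k (state i) u
  in-before zero    small u∈             = u∈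
  in-before (suc d) small (unit u≈ε)     = unit u≈ε
  in-before (suc d) small (older u∈)     = in-before d small u∈
  in-before {i = i} (suc d) small (newer _ n) =
    contradiction (ℕ.<-≤-trans small (ℕ.m≤n+m i d)) (new-large {d + i} n)

  B⇒in : ∀ {k i u} → Small i u → B k u → In k (state i) u
  B⇒in {i = i} small (j , u∈) = in-before j small (state-mono (ℕ.m≤m+n j i) u∈)

  -- New elements are large, so membership of `u` is settled by stage `size u + 1`. Decidability is
  -- what turns the negative information in `Δ` into membership.
  B? : ∀ k u → Dec (B k u)
  B? k u = Dec.map′ (λ u∈ → suc (size u) , u∈) (B⇒in ℕ.≤-refl) (in? k (state (suc (size u))) u)

  -- A new and an old factor never have a small product. Two new factors have one only if it is `ε`,
  -- the target or its inverse, and the target lies at most one level above the new elements.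
  product-step : ∀ {k i u v} → Small i (u ∙ v) →
    In k (state (suc i)) u → In k (state (suc i)) v →
    (In k (state i) u × In k (state i) v) ⊎ B (suc k) (u ∙ v)
  product-step small (unit u≈ε) (unit v≈ε) = inj₁ (unit u≈ε , unit v≈ε)
  product-step small (unit u≈ε) (older v∈) = inj₁ (unit u≈ε , v∈)
  product-step small (older u∈) (unit v≈ε) = inj₁ (u∈ , unit v≈ε)
  product-step small (older u∈) (older v∈) = inj₁ (u∈ , v∈)
  product-step {i = i} small (newer _ n) (unit v≈ε) =
    ⊥-elim (Step.new-old i {k = 0} n (unit v≈ε) small)
  product-step {i = i} small (newer _ n) (older v∈) = ⊥-elim (Step.new-old i n v∈ small)
  product-step {i = i} small (unit u≈ε) (newer _ n) =
    ⊥-elim (Step.new-old i {k = 0} (new-⁻¹ n) (in-⁻¹ (unit u≈ε))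
      (small-cong (⁻¹-anti-homo-∙ _ _) (small-⁻¹ small)))
  product-step {i = i} small (older u∈) (newer _ n) =
    ⊥-elim (Step.new-old i (new-⁻¹ n) (in-⁻¹ u∈)
      (small-cong (⁻¹-anti-homo-∙ _ _) (small-⁻¹ small)))
  product-step {i = i} small (newer l≤k m) (newer _ n) with Step.new-new i m n small
  ... | inj₁ uv≈ε          = inj₂ (i , unit uv≈ε)
  ... | inj₂ (inj₁ uv≈g)   =
    inj₂ (i , in-cong (sym uv≈g) (in-level (s≤s l≤k) (task-in (schedule i) (state i))))
  ... | inj₂ (inj₂ uv≈g⁻¹) =
    inj₂ (i , in-cong (sym uv≈g⁻¹) (in-⁻¹ (in-level (s≤s l≤k) (task-in (schedule i) (state i)))))

  -- Descent through the stages: what is small for `i` is small for every later stage, so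
  -- `product-step` applies each time.
  product : ∀ {k i u v} d → Small i (u ∙ v) →
    In k (state (d + i)) u → In k (state (d + i)) v →
    (In k (state i) u × In k (state i) v) ⊎ B (suc k) (u ∙ v)
  product zero small u∈ v∈ = inj₁ (u∈ , v∈)
  product {i = i} (suc d) small u∈ v∈
    with product-step (ℕ.<-≤-trans small (ℕ.m≤n+m i d)) u∈ v∈
  ... | inj₁ (u∈′ , v∈′) = product d small u∈′ v∈′
  ... | inj₂ uv∈B        = inj₂ uv∈B

  -- One application of `Δ` raises the level by one.

  -- If `g` is not in `B (suc k)`, every representation `g = x (g⁻¹ x)⁻¹` within `B k` already has
  -- `x` in the finite state `N`.
  ΔB⊆B : ∀ k → _⊆_ G (Δ G (B k)) (B (suc k))
  ΔB⊆B k g g∈Δ with B? (suc k) g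
  ... | yes g∈B = g∈B
  ... | no  g∉B = contradiction (finite-⊆ old (finite-in (state N))) g∈Δ
    where
    N = suc (size g)
    old : ∀ x → B k (g ⁻¹ ∙ x) × B k x → ∃ λ m → In m (state N) x
    old x ((i , v∈) , (j , x∈))
      with product (i + j) (small-cong (sym (x∙y⁻¹≈g g x)) ℕ.≤-refl)
        (state-mono (ℕ.≤-trans (ℕ.m≤n+m j i) (ℕ.m≤m+n (i + j) N)) x∈)
        (in-⁻¹ (state-mono (ℕ.≤-trans (ℕ.m≤m+n i j) (ℕ.m≤m+n (i + j) N)) v∈))
    ... | inj₁ (x∈N , _)  = k , x∈N
    ... | inj₂ (m , g∈)   = contradiction (m , in-cong (x∙y⁻¹≈g g x) g∈) g∉B

  -- Finitely many representations would have bounded size, but later stages with target `g` supply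
  -- ever larger ones.
  B⊆ΔB : ∀ k → _⊆_ G (B (suc k)) (Δ G (B k))
  B⊆ΔB k g (j , g∈) fin
    with N , reps<N ← finite⇒small fin
    -- Past `j` the element `g` is in the state, so the target is `g` and not the default; past `N`
    -- the new `x` exceeds the bound.
    with i , N≤i , sched ← schedule-recurs (index g) k (j ℕ.⊔ N)
    = new-large (new-x refl)
        (ℕ.<-≤-trans (reps<N (x-at i) (quotient∈B , suc i , newer l≤k (new-x refl)))
                     (ℕ.≤-trans (ℕ.m≤n⊔m j N) N≤i))
    where
    l≤k : level i ≤ k
    l≤k = ℕ.≤-reflexive (≡.cong proj₂ sched)
    target≈g : target i ≈ g
    target≈g = trans
      (reflexive (≡.trans (≡.cong (λ t → task t (state i)) sched)
        (task-enum (index g) k (state i)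
          (in-cong (sym (enum-index g)) (state-mono (ℕ.≤-trans (ℕ.m≤m⊔n j N) N≤i) g∈)))))
      (enum-index g)
    quotient∈B : B k (g ⁻¹ ∙ x-at i)
    quotient∈B = suc i , newer l≤k (new-y (∙-congʳ (⁻¹-cong (sym target≈g))))

  -- Strictness of the chain and its transfer to the iterates of `Δ`.

  B-mono : ∀ k → _⊆_ G (B k) (B (suc k))
  B-mono k g (i , g∈) = i , in-level (ℕ.n≤1+n k) g∈

  -- An element added at level `k + 1` is added only once: once `ε` is small, no new element is
  -- already old.
  B-proper : ∀ k → ∃ λ x → B (suc k) x × ¬ B k x
  -- The index 0 is arbitrary, as only the level matters; starting past `size ε` lets `new-not-old`
  -- apply.
  B-proper k with i , ε<i , sched ← schedule-recurs 0 (suc k) (suc (size ε)) =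
    x-at i , (suc i , newer (ℕ.≤-reflexive level≡) (new-x refl)) ,
    λ { (j , x∈) → x∉ j (state-mono (ℕ.m≤m+n j (suc i)) x∈) }
    where
    level≡ : level i ≡ suc k
    level≡ = ≡.cong proj₂ sched
    x∉ : ∀ d → ¬ In k (state (d + suc i)) (x-at i)
    x∉ zero (newer l≤k _) = ℕ.<-irrefl ≡.refl (≡.subst (_≤ k) level≡ l≤k)
    x∉ zero (older x∈)    = new-not-old {i} ε<i (new-x refl) x∈
    x∉ zero (unit x≈ε)    = new-not-old {i} {k} ε<i (new-x refl) (unit x≈ε)
    x∉ (suc d) (unit x≈ε) = new-not-old {i} {k} ε<i (new-x refl) (unit x≈ε)
    x∉ (suc d) (older x∈) = x∉ d x∈
    x∉ (suc d) (newer _ n) = new-not-old {d + suc i} {level i}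
      (ℕ.≤-trans ε<i (ℕ.≤-trans (ℕ.n≤1+n i) (ℕ.m≤n+m (suc i) d))) n
      (state-mono (ℕ.m≤n+m (suc i) d) (newer ℕ.≤-refl (new-x refl)))

  Δ-mono : ∀ {A A′} → _⊆_ G A A′ → _⊆_ G (Δ G A) (Δ G A′)
  Δ-mono A⊆A′ g g∈Δ fin =
    g∈Δ (finite-⊆ (λ { x (gx∈A , x∈A) → A⊆A′ _ gx∈A , A⊆A′ x x∈A }) fin)

  Δ^⊆B : ∀ n → _⊆_ G (Δ^ G n (B 0)) (B n)
  Δ^⊆B zero    g g∈ = g∈
  Δ^⊆B (suc n) g g∈ = ΔB⊆B n g (Δ-mono (Δ^⊆B n) g g∈)

  B⊆Δ^ : ∀ n → _⊆_ G (B n) (Δ^ G n (B 0))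
  B⊆Δ^ zero    g g∈ = g∈
  B⊆Δ^ (suc n) g g∈ = Δ-mono (B⊆Δ^ n) g (B⊆ΔB n g g∈)

  Δ^-strictly-increasing : ∀ n → _⊊_ G (Δ^ G n (B 0)) (Δ^ G (suc n) (B 0))
  Δ^-strictly-increasing n =
    (λ g → B⊆Δ^ (suc n) g ∘ B-mono n g ∘ Δ^⊆B n g) ,
    (let x , x∈ , x∉ = B-proper n in x , B⊆Δ^ (suc n) x x∈ , x∉ ∘ Δ^⊆B n x)

theorem5p4 : {c ℓ : Level} (G : Group c ℓ) →
    CountablyInfinite G →
    (∀ g → ¬ Group._≈_ G g (Group.ε G) →
    Finite G (λ x → Group._≈_ G (Group._∙_ G x x) g)) →
    ∃ λ (A : Subset G) → ∀ (n : ℕ) → _⊊_ G (Δ^ G n A) (Δ^ G (suc n) A)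
theorem5p4 G (enum , injective , surjective) square-roots = B 0 , Δ^-strictly-increasing
  where open Construction G enum injective surjective square-roots
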